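{- There exists a constant $k_1$ such that for every integer $m\ge1$ there exists an acyclic directed multigraph $D'_m$ with exactly $m$ arcs such that $\mathrm{mac}(D'_m)\le\frac m4+k_1m^{3/4}$.
   Context: A directed multigraph may have parallel arcs (but no loops); it is acyclic if it contains no directed cycle. For a directed multigraph, $\mathrm{mac}(D)$ is the maximum, over all partitions $(X,Y)$ of the vertex set, of the number of arcs (counted with multiplicity) going from $X$ to $Y$. -}

module Defs where

open import Data.Nat.Base as ℕ using (ℕ; zero; suc; _⊔_)
open import Data.Integer.Base using (+_)
open import Data.Rational.Base using (ℚ; 0ℚ; _≤_; _/_; +-*-rawSemiring)
open import Data.Fin.Base using (Fin)
open import Data.Fin.Subset using (Subset; inside; outside; _∈_; ∁)
open import Data.Fin.Subset.Properties using (_∈?_)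
open import Data.List.Base using (List; []; _∷_; _∷ʳ_; length; filter)
open import Data.List.Membership.Propositional renaming (_∈_ to _∈ₗ_) using ()
open import Data.List.Relation.Unary.All using (All)
open import Data.List.Relation.Unary.Linked using (Linked)
open import Data.List.Relation.Unary.Unique.Propositional using (Unique)
open import Data.Product.Base using (_×_; _,_)
open import Data.Vec.Base using ([]; _∷_)
open import Relation.Binary.PropositionalEquality using (_≢_)
open import Relation.Nullary using (¬_; Dec; _×-dec_)
open import Algebra.Definitions.RawSemiring +-*-rawSemiring using (_^_)

-- Parallel arcs are repeated entries of the list; the order of the list
-- plays no role.
record DirectedMultigraph : Set where
  field
    order    : ℕ
    arcs     : List (Fin order × Fin order)
    loopless : All (λ (u , v) → u ≢ v) arcs

  Vertex : Set
  Vertex = Fin order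

  _⟶_ : Vertex → Vertex → Set
  u ⟶ v = (u , v) ∈ₗ arcs

  size : ℕ
  size = length arcs

  -- The list v ∷ vs holds the vertices of the cycle, in order.
  IsDirectedCycle : Vertex → List Vertex → Set
  IsDirectedCycle v vs = Unique (v ∷ vs) × Linked _⟶_ (v ∷ vs ∷ʳ v)

  Acyclic : Set
  Acyclic = ∀ v vs → ¬ IsDirectedCycle v vs

  crosses? : (X Y : Subset order) (a : Vertex × Vertex) →
             Dec (let (u , v) = a in u ∈ X × v ∈ Y)
  crosses? X Y (u , v) = (u ∈? X) ×-dec (v ∈? Y)

  arcsFromTo : (X Y : Subset order) → ℕ
  arcsFromTo X Y = length (filter (crosses? X Y) arcs)

maxOverSubsets : ∀ n → (Subset n → ℕ) → ℕ
maxOverSubsets zero    f = f []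
maxOverSubsets (suc n) f =
  maxOverSubsets n (λ X → f (inside ∷ X)) ⊔ maxOverSubsets n (λ X → f (outside ∷ X))

-- The partitions (X , Y) of the vertex set are the pairs (X , ∁ X).  An
-- empty part is allowed; the corresponding cut has no arcs.
mac : DirectedMultigraph → ℕ
mac D = maxOverSubsets order (λ X → arcsFromTo X (∁ X))
  where open DirectedMultigraph D

-- q is a rational upper bound of the real number m^(3/4).  For a rational
-- k ≥ 0, the inequality  x ≤ y + k · m^(3/4)  between real numbers, with x
-- and y rational, holds exactly when  x ≤ y + k · q  for all such q.
_^¾≤_ : ℕ → ℚ → Set
m ^¾≤ q = 0ℚ ≤ q × + (m ℕ.^ 3) / 1 ≤ q ^ 4

{-# OPTIONS --safe #-}

-- Put a transitive tournament on each of q windows of t consecutive vertices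
-- on a line, where (t − 1)⁴ ≤ m < t⁴ and m = q (t choose 2) + r, and add r
-- copies of one arc.  Along a window a cut is a 0/1 word β, and the number of
-- its arcs that cross is the number N of pairs with a 1 before a 0.  If N′ is
-- the number of pairs with a 0 before a 1, and the word has P ones and Z zeros,
-- then N + N′ = P Z ≤ t²/4, while N − N′ = Σ_i (t − 1 − 2 i) β_i.  As the
-- coefficients t − 1 − 2 i sum to zero, N − N′ equals Φ(β) − Φ(shift β) for the
-- linear form Φ(β) = Σ_i (i + 1) (t − 1 − i) β_i and so telescopes along the
-- windows.  Hence 8 Σ N ≤ q t² + 4 t³ = 2 q (t choose 2) + q t + 4 t³, and q t
-- and t³ are O(m^(3/4)).
module Submission where

open import Defs
open import Data.Product.Base using (_×_; ∃-syntax; _,_; proj₂)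
open import Relation.Binary.PropositionalEquality
  using (_≡_; refl; sym; trans; cong; cong₂; subst)

-- Pair counts and the telescoping potential for 0/1 words.

module Words where

  open import Data.Nat.Base
  open import Data.Nat.Properties
  open import Data.Nat.Tactic.RingSolver using (solve-∀)
  open import Data.Bool.Base using (Bool; true; false; not)
  open import Data.Sum.Base using (inj₁; inj₂)
  open import Function.Base using (_∘_)

  -- The index is offset: this is the binomial coefficient t choose 2, the number of arcs of a
  -- transitive tournament on t vertices.
  triangle : ℕ → ℕ
  triangle zero    = 0
  triangle (suc t) = t + triangle t

  2*triangle : ∀ t → 2 * triangle (suc t) ≡ suc t * t
  2*triangle zero    = refl
  2*triangle (suc t) = trans (*-distribˡ-+ 2 (suc t) (triangle (suc t)))
    (trans (cong (2 * suc t +_) (2*triangle t)) (lem t))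
    where
    lem : ∀ t → 2 * suc t + suc t * t ≡ suc (suc t) * suc t
    lem = solve-∀

  bit : Bool → ℕ
  bit false = 0
  bit true  = 1

  ones : (ℕ → Bool) → ℕ → ℕ
  ones β zero    = 0
  ones β (suc t) = bit (β t) + ones β t

  zeros : (ℕ → Bool) → ℕ → ℕ
  zeros β = ones (not ∘ β)

  -- All pairs of positions count here, not only adjacent ones: this is the number N.
  descents : (ℕ → Bool) → ℕ → ℕ
  descents β zero    = 0
  descents β (suc t) = bit (not (β t)) * ones β t + descents β t

  moment : (ℕ → Bool) → ℕ → ℕ
  moment β zero    = 0
  moment β (suc t) = suc t * bit (β t) + moment β t

  -- The recursive form of Φ.
  potential : (ℕ → Bool) → ℕ → ℕ
  potential β zero    = 0
  potential β (suc t) = moment β t + potential β t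

  ones+zeros : ∀ β t → ones β t + zeros β t ≡ t
  ones+zeros β zero = refl
  ones+zeros β (suc t) with β t
  ... | true  = cong suc (ones+zeros β t)
  ... | false = trans (+-suc (ones β t) (zeros β t)) (cong suc (ones+zeros β t))

  -- The shift lowers the weight of every letter by one, so the loss is one for each 1 in the word.
  moment-shift : ∀ β t → moment (β ∘ suc) t + ones β (suc t) ≡ moment β (suc t)
  moment-shift β zero    = lem (bit (β 0))
    where
    lem : ∀ b → 0 + (b + 0) ≡ 1 * b + 0
    lem = solve-∀
  moment-shift β (suc t) = trans
    (lem (suc t) (bit (β (suc t))) (moment (β ∘ suc) t) (ones β (suc t)))
    (cong (suc (suc t) * bit (β (suc t)) +_) (moment-shift β t))
    where
    lem : ∀ t b e p → t * b + e + (b + p) ≡ suc t * b + (e + p)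
    lem = solve-∀

  -- The number N′ is eliminated, so that no subtraction occurs: 2 N = P Z + (N − N′).
  potential-shift : ∀ β t →
    2 * descents β t + potential (β ∘ suc) t ≡ potential β t + ones β t * zeros β t
  potential-shift β zero    = refl
  potential-shift β (suc t)
    with β t | moment-shift β t | ones+zeros β t | potential-shift β t
  -- A final 0 adds 2 P to 2 N and P to P Z. By `sh` the shifted moment is smaller than the original
  -- one by exactly P, which balances the two.
  ... | false | sh | _  | ih = trans
      (lem₁ (descents β t) (potential (β ∘ suc) t) (moment (β ∘ suc) t) (ones β t))
      (trans (cong₂ (λ x y → x + y + ones β t) ih sh)
             (lem₂ (potential β t) (ones β t) (zeros β t) (moment β t) t))
    where
    lem₁ : ∀ d f e p → 2 * (1 * p + d) + (e + f) ≡ (2 * d + f) + (e + (0 + p)) + p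
    lem₁ = solve-∀
    lem₂ : ∀ f p z e t → f + p * z + (suc t * 0 + e) + p ≡ e + f + (0 + p) * (1 + z)
    lem₂ = solve-∀
  -- A final 1 leaves N unchanged and adds Z to P Z, so the shifted moment has to exceed the
  -- original one by Z.
  ... | true  | sh | oz | ih = trans
      (lem₁ (descents β t) (potential (β ∘ suc) t) (ones β t) (moment (β ∘ suc) t))
      (trans (cong₂ _+_ ih moment≡)
             (lem₂ (potential β t) (ones β t) (zeros β t) (moment β t)))
    where
    lem₁ : ∀ d f p e → 2 * (0 * p + d) + (e + f) ≡ (2 * d + f) + e
    lem₁ = solve-∀
    lem₂ : ∀ f p z e → f + p * z + (z + e) ≡ e + f + (1 + p) * (0 + z)
    lem₂ = solve-∀
    lem₃ : ∀ p z e → (1 + (p + z)) * 1 + e ≡ z + e + (1 + p)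
    lem₃ = solve-∀
    -- In `sh` the final 1 has weight t + 1 on the right; with t = P + Z, cancelling the 1 + P ones
    -- leaves Z.
    moment≡ : moment (β ∘ suc) t ≡ zeros β t + moment β t
    moment≡ = +-cancelʳ-≡ (1 + ones β t) _ _ (trans sh (trans
      (cong (λ x → suc x * 1 + moment β t) (sym oz))
      (lem₃ (ones β t) (zeros β t) (moment β t))))

  4mn≤[m+n]² : ∀ m n → 4 * (m * n) ≤ (m + n) * (m + n)
  4mn≤[m+n]² m n with ≤-total m n
  ... | inj₁ m≤n = subst (λ n → 4 * (m * n) ≤ (m + n) * (m + n)) (m+[n∸m]≡n m≤n)
      (subst (4 * (m * (m + (n ∸ m))) ≤_) (lem m (n ∸ m)) (m≤m+n _ _))
    where
    lem : ∀ m d → 4 * (m * (m + d)) + d * d ≡ (m + (m + d)) * (m + (m + d))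
    lem = solve-∀
  ... | inj₂ n≤m = subst (λ m → 4 * (m * n) ≤ (m + n) * (m + n)) (m+[n∸m]≡n n≤m)
      (subst (4 * ((n + (m ∸ n)) * n) ≤_) (lem n (m ∸ n)) (m≤m+n _ _))
    where
    lem : ∀ n d → 4 * ((n + d) * n) + d * d ≡ (n + d + n) * (n + d + n)
    lem = solve-∀

  -- Four times `potential-shift`, with 4 P Z ≤ t². The shifted potential stays on the left, ready
  -- to cancel against the bound for the next window.
  descents-bound : ∀ β t →
    8 * descents β t + 4 * potential (β ∘ suc) t ≤ t * t + 4 * potential β t
  descents-bound β t = begin
    8 * descents β t + 4 * potential (β ∘ suc) t
      ≡⟨ lem₁ (descents β t) (potential (β ∘ suc) t) ⟩
    4 * (2 * descents β t + potential (β ∘ suc) t)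
      ≡⟨ cong (4 *_) (potential-shift β t) ⟩
    4 * (potential β t + ones β t * zeros β t)
      ≡⟨ lem₂ (potential β t) (ones β t * zeros β t) ⟩
    4 * (ones β t * zeros β t) + 4 * potential β t
      ≤⟨ +-monoˡ-≤ _ (4mn≤[m+n]² (ones β t) (zeros β t)) ⟩
    (ones β t + zeros β t) * (ones β t + zeros β t) + 4 * potential β t
      ≡⟨ cong (λ x → x * x + 4 * potential β t) (ones+zeros β t) ⟩
    t * t + 4 * potential β t ∎
    where
    open ≤-Reasoning
    lem₁ : ∀ d f → 8 * d + 4 * f ≡ 4 * (2 * d + f)
    lem₁ = solve-∀
    lem₂ : ∀ f x → 4 * (f + x) ≡ 4 * x + 4 * f
    lem₂ = solve-∀

  bit≤1 : ∀ b → bit b ≤ 1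
  bit≤1 false = z≤n
  bit≤1 true  = s≤s z≤n

  moment≤t² : ∀ β t → moment β t ≤ t * t
  moment≤t² β zero    = z≤n
  moment≤t² β (suc t) = begin
    suc t * bit (β t) + moment β t ≤⟨ +-mono-≤ (*-monoʳ-≤ (suc t) (bit≤1 (β t))) (moment≤t² β t) ⟩
    suc t * 1 + t * t              ≤⟨ m≤m+n _ t ⟩
    suc t * 1 + t * t + t          ≡⟨ lem t ⟩
    suc t * suc t                  ∎
    where
    open ≤-Reasoning
    lem : ∀ t → suc t * 1 + t * t + t ≡ suc t * suc t
    lem = solve-∀

  -- A crude cubic bound suffices: one potential survives the telescoping, and t has order m^(1/4).
  potential≤t³ : ∀ β t → potential β t ≤ t * t * t
  potential≤t³ β zero    = z≤n
  potential≤t³ β (suc t) = begin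
    moment β t + potential β t            ≤⟨ +-mono-≤ (moment≤t² β t) (potential≤t³ β t) ⟩
    t * t + t * t * t                     ≤⟨ m≤m+n _ _ ⟩
    t * t + t * t * t + (2 * t * t + 3 * t + 1) ≡⟨ lem t ⟩
    suc t * suc t * suc t                 ∎
    where
    open ≤-Reasoning
    lem : ∀ t → t * t + t * t * t + (2 * t * t + 3 * t + 1) ≡ suc t * suc t * suc t
    lem = solve-∀

-- Overlapping transitive tournaments and their cuts.

module Windows {A : Set} where

  open import Level using (0ℓ)

  open import Data.Nat.Base
  open import Data.Nat.Properties
  open import Data.Nat.Tactic.RingSolver using (solve-∀)
  open import Data.List.Base
  open import Data.List.Properties
  open import Data.List.Relation.Unary.All using (All; []; _∷_)
  open import Data.List.Relation.Unary.All.Properties using (++⁺; applyDownFrom⁺₁)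
  open import Function.Base using (_∘_)
  open import Relation.Nullary.Decidable using (yes; no; does; ¬?; _×-dec_)
  open import Relation.Unary using (Pred; Decidable)
  open Words

  star : (ℕ → A) → ℕ → A → List (A × A)
  star f k v = applyDownFrom (λ i → f i , v) k

  tournament : (ℕ → A) → ℕ → List (A × A)
  tournament f zero    = []
  tournament f (suc t) = star f t (f t) ++ tournament f t

  -- Successive windows start one vertex apart, so a pair of vertices lying in several windows gets
  -- parallel arcs. Since vertices are given by a sequence, moving to the next window is composition
  -- with `suc`, the same shift as on words.
  windows : (ℕ → A) → ℕ → ℕ → List (A × A)
  windows f t zero    = []
  windows f t (suc q) = tournament f t ++ windows (f ∘ suc) t q

  length-tournament : ∀ f t → length (tournament f t) ≡ triangle t
  length-tournament f zero    = refl
  length-tournament f (suc t) = trans (length-++ (star f t (f t)))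
    (cong₂ _+_ (length-applyDownFrom (λ i → f i , f t) t) (length-tournament f t))

  length-windows : ∀ f t q → length (windows f t q) ≡ q * triangle t
  length-windows f t zero    = refl
  length-windows f t (suc q) = trans (length-++ (tournament f t))
    (cong₂ _+_ (length-tournament f t) (length-windows (f ∘ suc) t q))

  module _ {R : A → A → Set} where

    tournament-All : ∀ f t → (∀ {i j} → i < j → j < t → R (f i) (f j)) →
                     All (λ (u , v) → R u v) (tournament f t)
    tournament-All f zero    Rf = []
    tournament-All f (suc t) Rf = ++⁺
      (applyDownFrom⁺₁ _ t (λ i<t → Rf i<t ≤-refl))
      (tournament-All f t (λ i<j j<t → Rf i<j (m<n⇒m<1+n j<t)))

    windows-All : ∀ f t q → (∀ {i j} → i < j → j < q + t → R (f i) (f j)) →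
                  All (λ (u , v) → R u v) (windows f t q)
    windows-All f t zero    Rf = []
    windows-All f t (suc q) Rf = ++⁺
      (tournament-All f t (λ i<j j<t → Rf i<j (<-≤-trans j<t (m≤n+m t (suc q)))))
      (windows-All (f ∘ suc) t q (λ i<j j<q+t → Rf (s≤s i<j) (s≤s j<q+t)))

  module _ {P : Pred A 0ℓ} (P? : Decidable P) where

    cut : List (A × A) → ℕ
    cut = length ∘ filter (λ (u , v) → P? u ×-dec ¬? (P? v))

    cut-++ : ∀ as bs → cut (as ++ bs) ≡ cut as + cut bs
    cut-++ as bs = trans (cong length (filter-++ _ as bs)) (length-++ (filter _ as))

    cut-star : ∀ f k v → cut (star f k v) ≡ bit (does (¬? (P? v))) * ones (does ∘ P? ∘ f) k
    cut-star f zero    v = sym (*-zeroʳ (bit (does (¬? (P? v)))))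
    cut-star f (suc k) v with P? (f k) | P? v | cut-star f k v
    ... | yes _ | yes _ | ih = ih
    ... | yes _ | no  _ | ih = cong suc ih
    ... | no  _ | yes _ | ih = ih
    ... | no  _ | no  _ | ih = ih

    cut-tournament : ∀ f t → cut (tournament f t) ≡ descents (does ∘ P? ∘ f) t
    cut-tournament f zero    = refl
    cut-tournament f (suc t) = trans (cut-++ (star f t (f t)) _)
      (cong₂ _+_ (cut-star f t (f t)) (cut-tournament f t))

    -- The induction hypothesis for the remaining windows contributes the potential of the shifted
    -- word, exactly the term on the left of `descents-bound`. Only the potential of the first
    -- window remains.
    cut-windows : ∀ f t q → 8 * cut (windows f t q) ≤
                  q * (t * t) + 4 * potential (does ∘ P? ∘ f) t
    cut-windows f t zero    = z≤n
    cut-windows f t (suc q) = begin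
      8 * cut (tournament f t ++ windows (f ∘ suc) t q)
        ≡⟨ cong (8 *_) (trans (cut-++ (tournament f t) _) (cong (_+ rest) (cut-tournament f t))) ⟩
      8 * (descents β t + rest)
        ≡⟨ *-distribˡ-+ 8 (descents β t) rest ⟩
      8 * descents β t + 8 * rest
        ≤⟨ +-monoʳ-≤ (8 * descents β t) (cut-windows (f ∘ suc) t q) ⟩
      8 * descents β t + (q * (t * t) + 4 * potential (β ∘ suc) t)
        ≡⟨ lem (8 * descents β t) (q * (t * t)) (4 * potential (β ∘ suc) t) ⟩
      q * (t * t) + (8 * descents β t + 4 * potential (β ∘ suc) t)
        ≤⟨ +-monoʳ-≤ (q * (t * t)) (descents-bound β t) ⟩
      q * (t * t) + (t * t + 4 * potential β t)
        ≡⟨ lem′ (q * (t * t)) (t * t) (4 * potential β t) ⟩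
      suc q * (t * t) + 4 * potential β t ∎
      where
      open ≤-Reasoning
      β = does ∘ P? ∘ f
      rest = cut (windows (f ∘ suc) t q)
      lem : ∀ x y z → x + (y + z) ≡ y + (x + z)
      lem = solve-∀
      lem′ : ∀ x y z → x + (y + z) ≡ y + x + z
      lem′ = solve-∀

-- The acyclic multigraph on a line and its maximum cut.

module Digraphs where

  open import Data.Nat.Base
  open import Data.Nat.Properties
  open import Data.Nat.DivMod using (_%_; _mod_; m%n<n; m<n⇒m%n≡m)
  open import Data.Fin.Base using (Fin; toℕ)
  open import Data.Fin.Properties using (toℕ-fromℕ<)
  open import Data.Fin.Subset using (∁)
  open import Data.Fin.Subset.Properties using (_∈?_; x∉p⇒x∈∁p; x∈∁p⇒x∉p)
  open import Data.List.Base using (List; _++_; replicate; length)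
  open import Data.List.Properties using (length-++; length-replicate; length-filter; filter-≐)
  open import Data.List.Relation.Unary.All as All using (All; _∷_)
  open import Data.List.Relation.Unary.All.Properties using (++⁺; ∷ʳ⁻; replicate⁺)
  open import Data.List.Relation.Unary.AllPairs using (_∷_)
  import Data.List.Relation.Unary.Linked as Linked
  open import Data.List.Relation.Unary.Linked.Properties using (Linked⇒AllPairs)
  open import Data.Vec.Base using ([]; _∷_)
  open import Function.Base using (_∘_)
  open import Relation.Nullary.Decidable using (does)
  open import Relation.Binary.PropositionalEquality using (subst₂)
  open Words
  open Windows
  open DirectedMultigraph

  Forward : ∀ {n} → List (Fin n × Fin n) → Set
  Forward = All (λ (u , v) → toℕ u < toℕ v)

  forwardDigraph : ∀ {n} (as : List (Fin n × Fin n)) → Forward as → DirectedMultigraph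
  forwardDigraph as fwd = record
    { arcs     = as
    ; loopless = All.map (λ u<v u≡v → <⇒≢ u<v (cong toℕ u≡v)) fwd
    }

  -- Vertex numbers increase along arcs, so by transitivity the first vertex of a cycle is smaller
  -- than every later entry, including its own closing occurrence.
  forward-acyclic : ∀ {n} (as : List (Fin n × Fin n)) (fwd : Forward as) →
                    Acyclic (forwardDigraph as fwd)
  forward-acyclic as fwd v vs (_ , cycle)
    with Linked⇒AllPairs <-trans′ (Linked.map (All.lookup fwd) cycle)
    where
    <-trans′ : ∀ {u v w} → toℕ u < toℕ v → toℕ v < toℕ w → toℕ u < toℕ w
    <-trans′ = <-trans
  ... | v<all ∷ _ = <-irrefl refl (proj₂ (∷ʳ⁻ v<all))

  *-maxOverSubsets-≤ : ∀ c n {f b} → (∀ X → c * f X ≤ b) → c * maxOverSubsets n f ≤ b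
  *-maxOverSubsets-≤ c zero    cf≤b = cf≤b []
  *-maxOverSubsets-≤ c (suc n) cf≤b = subst (_≤ _) (sym (*-distribˡ-⊔ c _ _))
    (⊔-lub (*-maxOverSubsets-≤ c n (λ X → cf≤b (_ ∷ X)))
           (*-maxOverSubsets-≤ c n (λ X → cf≤b (_ ∷ X))))

  module _ (s q r : ℕ) where

    private
      t n : ℕ
      -- At least two vertices per window: the extra arc from 0 to 1 then exists, and a window has
      -- at least one arc.
      t = 2 + s
      n = q + t

    instance
      n≢0 : NonZero n
      n≢0 = >-nonZero (<-≤-trans (s≤s z≤n) (m≤n+m t q))

    -- Reduction modulo n makes the sequence total; all positions that occur as ends of arcs are
    -- below n, so none wraps around.
    vertex : ℕ → Fin n
    vertex i = i mod n

    toℕ-vertex : ∀ {i} → i < n → toℕ (vertex i) ≡ i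
    toℕ-vertex {i} i<n = trans (toℕ-fromℕ< (m%n<n i n)) (m<n⇒m%n≡m i<n)

    vertex-mono : ∀ {i j} → i < j → j < n → toℕ (vertex i) < toℕ (vertex j)
    vertex-mono i<j j<n =
      subst₂ _<_ (sym (toℕ-vertex (<-trans i<j j<n))) (sym (toℕ-vertex j<n)) i<j

    extraArcs allArcs : List (Fin n × Fin n)
    extraArcs = replicate r (vertex 0 , vertex 1)
    allArcs   = extraArcs ++ windows vertex t q

    allArcs-forward : Forward allArcs
    allArcs-forward = ++⁺
      (replicate⁺ r (vertex-mono (s≤s z≤n) (<-≤-trans (s≤s (s≤s z≤n)) (m≤n+m t q))))
      (windows-All vertex t q vertex-mono)

    windowDigraph : DirectedMultigraph
    windowDigraph = forwardDigraph allArcs allArcs-forward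

    windowDigraph-size : size windowDigraph ≡ r + q * triangle t
    windowDigraph-size = trans (length-++ extraArcs)
      (cong₂ _+_ (length-replicate r) (length-windows vertex t q))

    -- The r extra arcs are all allowed to cross; the windows are bounded by telescoping and the
    -- cubic bound on the potential.
    arcsFromTo-≤ : ∀ X → 8 * arcsFromTo windowDigraph X (∁ X) ≤
                   8 * r + (q * (t * t) + 4 * (t * t * t))
    arcsFromTo-≤ X = begin
      8 * arcsFromTo windowDigraph X (∁ X)
        ≡⟨ cong (λ as → 8 * length as) (filter-≐ (crosses? windowDigraph X (∁ X)) _
             ((λ (u∈ , v∈) → u∈ , x∈∁p⇒x∉p v∈) , (λ (u∈ , v∉) → u∈ , x∉p⇒x∈∁p v∉)) allArcs) ⟩
      8 * cut (_∈? X) allArcs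
        ≡⟨ cong (8 *_) (cut-++ (_∈? X) extraArcs _) ⟩
      8 * (cut (_∈? X) extraArcs + cut (_∈? X) (windows vertex t q))
        ≡⟨ *-distribˡ-+ 8 (cut (_∈? X) extraArcs) _ ⟩
      8 * cut (_∈? X) extraArcs + 8 * cut (_∈? X) (windows vertex t q)
        ≤⟨ +-mono-≤
             (*-monoʳ-≤ 8 (≤-trans (length-filter _ extraArcs) (≤-reflexive (length-replicate r))))
             (≤-trans (cut-windows (_∈? X) vertex t q)
                      (+-monoʳ-≤ (q * (t * t)) (*-monoʳ-≤ 4 (potential≤t³ (does ∘ (_∈? X) ∘ vertex) t)))) ⟩
      8 * r + (q * (t * t) + 4 * (t * t * t)) ∎
      where open ≤-Reasoning

    mac-≤ : 8 * mac windowDigraph ≤ 8 * r + (q * (t * t) + 4 * (t * t * t))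
    mac-≤ = *-maxOverSubsets-≤ 8 n arcsFromTo-≤

-- Choice of window length and number of windows.

module Parameters where

  open import Data.Nat.Base
  open import Data.Nat.Properties
  open import Data.Nat.DivMod using (_%_; _/_; m%n<n; m≡m%n+[m/n]*n)
  open import Data.Nat.Tactic.RingSolver using (solve-∀)
  open import Relation.Nullary.Decidable using (yes; no)
  open Words
  open Digraphs
  open DirectedMultigraph

  fourthRoot : ∀ m → 1 ≤ m → ∃[ s ] (suc s ^ 4 ≤ m × m < suc (suc s) ^ 4)
  fourthRoot (suc zero)    _ = 0 , s≤s z≤n , s≤s (s≤s z≤n)
  fourthRoot (suc (suc m)) _ with fourthRoot (suc m) (s≤s z≤n)
  ... | s , lb , ub with suc (suc m) <? suc (suc s) ^ 4
  ...   | yes <ub = s , m≤n⇒m≤1+n lb , <ub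
  -- Here `ub` is read as m + 2 ≤ (2 + s)⁴, where m is the pattern variable; the next fourth power
  -- is strictly larger.
  ...   | no  ≮ub = suc s , ≮⇒≥ ≮ub , ≤-<-trans ub (^-monoˡ-< 4 (n<1+n (2 + s)))

  -- From t² = t (t - 1) + t the main term is q t (t - 1) = 2 q T. The rest, 6 r + q t + 4 t³, is at
  -- most (6 + 4 + 4) t³, and t ≤ 2 (t - 1) gives 14 t³ ≤ 2 · 56 (t - 1)³. The cube of t - 1 is
  -- wanted because (t - 1)⁴ ≤ m.
  excess-≤ : ∀ s q r → r < triangle (2 + s) → r + q * triangle (2 + s) ≤ (2 + s) ^ 4 →
    8 * r + (q * ((2 + s) * (2 + s)) + 4 * ((2 + s) * (2 + s) * (2 + s)))
      ≤ 2 * (r + q * triangle (2 + s) + 56 * suc s ^ 3)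
  excess-≤ s q r r<T m≤t⁴ = begin
    8 * r + (q * (t * t) + 4 * c)
      ≡⟨ lem₁ r q σ c ⟩
    2 * r + q * (t * σ) + (6 * r + q * t + 4 * c)
      ≤⟨ +-monoʳ-≤ (2 * r + q * (t * σ)) (+-monoˡ-≤ (4 * c) (+-mono-≤ 6r≤6c qt≤4c)) ⟩
    2 * r + q * (t * σ) + (6 * c + 4 * c + 4 * c)
      ≡⟨ cong (λ x → 2 * r + q * x + (6 * c + 4 * c + 4 * c)) (sym (2*triangle σ)) ⟩
    2 * r + q * (2 * T) + (6 * c + 4 * c + 4 * c)
      ≡⟨ lem₂ r q T c ⟩
    2 * (r + q * T + 7 * c)
      ≤⟨ *-monoʳ-≤ 2 (+-monoʳ-≤ (r + q * T) (*-monoʳ-≤ 7 c≤8σ³)) ⟩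
    2 * (r + q * T + 7 * (2 * σ * (2 * σ) * (2 * σ)))
      ≡⟨ cong (λ x → 2 * (r + q * T + x)) (lem₃ σ) ⟩
    2 * (r + q * T + 56 * σ ^ 3) ∎
    where
    open ≤-Reasoning
    σ = 1 + s
    t = 2 + s
    c = t * t * t
    T = triangle t
    lem₁ : ∀ r q σ c → 8 * r + (q * (suc σ * suc σ) + 4 * c) ≡
                       2 * r + q * (suc σ * σ) + (6 * r + q * suc σ + 4 * c)
    lem₁ = solve-∀
    lem₂ : ∀ r q T c → 2 * r + q * (2 * T) + (6 * c + 4 * c + 4 * c) ≡ 2 * (r + q * T + 7 * c)
    lem₂ = solve-∀
    lem₃ : ∀ x → 7 * (2 * x * (2 * x) * (2 * x)) ≡ 56 * (x * (x * (x * 1)))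
    lem₃ = solve-∀
    t≤2σ : t ≤ 2 * σ
    t≤2σ = subst (t ≤_) (lem s) (m≤m+n t s)
      where
      lem : ∀ s → 2 + s + s ≡ 2 * (1 + s)
      lem = solve-∀
    c≤8σ³ : c ≤ 2 * σ * (2 * σ) * (2 * σ)
    c≤8σ³ = *-mono-≤ (*-mono-≤ t≤2σ t≤2σ) t≤2σ
    T≤c : T ≤ c
    T≤c = begin
      T         ≤⟨ m≤m+n T (T + 0) ⟩
      2 * T     ≡⟨ 2*triangle σ ⟩
      t * σ     ≤⟨ *-monoʳ-≤ t (n≤1+n σ) ⟩
      t * t     ≤⟨ m≤m*n (t * t) t ⟩
      c         ∎
    6r≤6c : 6 * r ≤ 6 * c
    6r≤6c = *-monoʳ-≤ 6 (≤-trans (<⇒≤ r<T) T≤c)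
    qσ≤2c : q * σ ≤ 2 * c
    -- After multiplication by t the left side is 2 q T, at most twice the number of arcs and hence
    -- at most 2 t⁴.
    qσ≤2c = *-cancelʳ-≤ (q * σ) (2 * c) t (begin
      q * σ * t         ≡⟨ lem₄ q σ t ⟩
      q * (t * σ)       ≡⟨ cong (q *_) (sym (2*triangle σ)) ⟩
      q * (2 * T)       ≡⟨ lem₅ q T ⟩
      2 * (q * T)       ≤⟨ *-monoʳ-≤ 2 (≤-trans (m≤n+m (q * T) r) m≤t⁴) ⟩
      2 * t ^ 4         ≡⟨ lem₆ t ⟩
      2 * c * t         ∎)
      where
      lem₄ : ∀ q σ t → q * σ * t ≡ q * (t * σ)
      lem₄ = solve-∀
      lem₅ : ∀ q T → q * (2 * T) ≡ 2 * (q * T)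
      lem₅ = solve-∀
      lem₆ : ∀ t → 2 * (t * (t * (t * (t * 1)))) ≡ 2 * (t * t * t) * t
      lem₆ = solve-∀
    qt≤4c : q * t ≤ 4 * c
    qt≤4c = begin
      q * t         ≤⟨ *-monoʳ-≤ q t≤2σ ⟩
      q * (2 * σ)   ≡⟨ lem q σ ⟩
      2 * (q * σ)   ≤⟨ *-monoʳ-≤ 2 qσ≤2c ⟩
      2 * (2 * c)   ≡⟨ lem′ c ⟩
      4 * c         ∎
      where
      lem : ∀ q σ → q * (2 * σ) ≡ 2 * (q * σ)
      lem = solve-∀
      lem′ : ∀ c → 2 * (2 * c) ≡ 4 * c
      lem′ = solve-∀

  small-mac : ∀ m → 1 ≤ m → ∃[ s ] ∃[ D ]
    (s ^ 4 ≤ m × Acyclic D × size D ≡ m × 4 * mac D ≤ m + 56 * s ^ 3)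
  small-mac m 1≤m with fourthRoot m 1≤m
  -- The number returned is t - 1, whose fourth power is at most m, and not the window length t = 2
  -- + s.
  ... | s , lb , ub = suc s , D , lb , forward-acyclic _ (allArcs-forward s q r) ,
      trans (windowDigraph-size s q r) (sym m≡) , *-cancelˡ-≤ 2 (begin
        2 * (4 * mac D)
          ≡⟨ lem (mac D) ⟩
        8 * mac D
          ≤⟨ mac-≤ s q r ⟩
        8 * r + (q * ((2 + s) * (2 + s)) + 4 * ((2 + s) * (2 + s) * (2 + s)))
          ≤⟨ excess-≤ s q r (m%n<n m T) (subst (_≤ _) m≡ (<⇒≤ ub)) ⟩
        2 * (r + q * T + 56 * suc s ^ 3)
          ≡⟨ cong (λ x → 2 * (x + 56 * suc s ^ 3)) (sym m≡) ⟩
        2 * (m + 56 * suc s ^ 3) ∎)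
    where
    open ≤-Reasoning
    T = triangle (2 + s)
    q = m / T
    r = m % T
    D = windowDigraph s q r
    m≡ : m ≡ r + q * T
    m≡ = m≡m%n+[m/n]*n m T
    lem : ∀ x → 2 * (4 * x) ≡ 8 * x
    lem = solve-∀

-- Transfer to rational bounds.

open import Data.Nat.Base as ℕ using (ℕ; zero; suc)
import Data.Nat.Properties as ℕ
open import Data.Integer.Base as ℤ using (+_)
import Data.Integer.Properties as ℤ
open import Data.Rational.Base
  using (ℚ; 0ℚ; 1ℚ; _≤_; _<_; _/_; _+_; _*_; toℚᵘ; Positive; positive; nonNegative; +-*-rawSemiring)
open import Data.Rational.Properties
open import Data.Rational.Unnormalised.Base as ℚᵘ using (mkℚᵘ; *≡*)
import Data.Rational.Unnormalised.Properties as ℚᵘ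
open import Algebra.Definitions.RawSemiring +-*-rawSemiring using (_^_)
open DirectedMultigraph using (Acyclic; size)
open Parameters using (small-mac)

-- `_/_` normalises its result and so does not compute on variables; arithmetic on integers inside ℚ
-- is therefore checked on unnormalised fractions.
toℚᵘ-/1 : ∀ i → toℚᵘ (i / 1) ℚᵘ.≃ mkℚᵘ i 0
toℚᵘ-/1 i = toℚᵘ-fromℚᵘ (mkℚᵘ i 0)

/1-homo-+ : ∀ a b → + (a ℕ.+ b) / 1 ≡ + a / 1 + + b / 1
/1-homo-+ a b = toℚᵘ-injective (begin
  toℚᵘ (+ (a ℕ.+ b) / 1)            ≈⟨ toℚᵘ-/1 (+ (a ℕ.+ b)) ⟩
  -- Unnormalised addition cross-multiplies, hence numerators a * 1 and b * 1.
  mkℚᵘ (+ (a ℕ.+ b)) 0              ≡⟨ cong (λ i → mkℚᵘ i 0) (cong₂ ℤ._+_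
                                        (sym (ℤ.*-identityʳ (+ a))) (sym (ℤ.*-identityʳ (+ b)))) ⟩
  mkℚᵘ (+ a) 0 ℚᵘ.+ mkℚᵘ (+ b) 0    ≈⟨ ℚᵘ.+-cong (toℚᵘ-/1 (+ a)) (toℚᵘ-/1 (+ b)) ⟨
  toℚᵘ (+ a / 1) ℚᵘ.+ toℚᵘ (+ b / 1) ≈⟨ toℚᵘ-homo-+ (+ a / 1) (+ b / 1) ⟨
  toℚᵘ (+ a / 1 + + b / 1)          ∎)
  where open import Relation.Binary.Reasoning.Setoid ℚᵘ.≃-setoid

/1-homo-* : ∀ a b → + (a ℕ.* b) / 1 ≡ (+ a / 1) * (+ b / 1)
/1-homo-* a b = toℚᵘ-injective (begin
  toℚᵘ (+ (a ℕ.* b) / 1)            ≈⟨ toℚᵘ-/1 (+ (a ℕ.* b)) ⟩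
  mkℚᵘ (+ (a ℕ.* b)) 0              ≡⟨ cong (λ i → mkℚᵘ i 0) (ℤ.pos-* a b) ⟩
  mkℚᵘ (+ a) 0 ℚᵘ.* mkℚᵘ (+ b) 0    ≈⟨ ℚᵘ.*-cong (toℚᵘ-/1 (+ a)) (toℚᵘ-/1 (+ b)) ⟨
  toℚᵘ (+ a / 1) ℚᵘ.* toℚᵘ (+ b / 1) ≈⟨ toℚᵘ-homo-* (+ a / 1) (+ b / 1) ⟨
  toℚᵘ ((+ a / 1) * (+ b / 1))      ∎)
  where open import Relation.Binary.Reasoning.Setoid ℚᵘ.≃-setoid

4*[m/4]≡m : ∀ m → (+ 4 / 1) * (+ m / 4) ≡ + m / 1
4*[m/4]≡m m = toℚᵘ-injective (begin
  toℚᵘ ((+ 4 / 1) * (+ m / 4))      ≈⟨ toℚᵘ-homo-* (+ 4 / 1) (+ m / 4) ⟩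
  toℚᵘ (+ 4 / 1) ℚᵘ.* toℚᵘ (+ m / 4) ≈⟨ ℚᵘ.*-cong (toℚᵘ-/1 (+ 4)) (toℚᵘ-fromℚᵘ (mkℚᵘ (+ m) 3)) ⟩
  mkℚᵘ (+ 4) 0 ℚᵘ.* mkℚᵘ (+ m) 3    ≈⟨ *≡* (trans (ℤ.*-identityʳ (+ 4 ℤ.* + m)) (ℤ.*-comm (+ 4) (+ m))) ⟩
  mkℚᵘ (+ m) 0                      ≈⟨ toℚᵘ-/1 (+ m) ⟨
  toℚᵘ (+ m / 1)                    ∎)
  where open import Relation.Binary.Reasoning.Setoid ℚᵘ.≃-setoid

/1-homo-^ : ∀ a n → + (a ℕ.^ n) / 1 ≡ (+ a / 1) ^ n
/1-homo-^ a zero    = refl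
/1-homo-^ a (suc n) = trans (/1-homo-* a (a ℕ.^ n)) (cong ((+ a / 1) *_) (/1-homo-^ a n))

/1-mono-≤ : ∀ {a b} → a ℕ.≤ b → + a / 1 ≤ + b / 1
/1-mono-≤ {a} {b} a≤b = toℚᵘ-cancel-≤ (begin
  toℚᵘ (+ a / 1) ≃⟨ toℚᵘ-/1 (+ a) ⟩
  mkℚᵘ (+ a) 0   ≤⟨ ℚᵘ.*≤* (ℤ.*-monoʳ-≤-nonNeg (+ 1) (ℤ.+≤+ a≤b)) ⟩
  mkℚᵘ (+ b) 0   ≃⟨ toℚᵘ-/1 (+ b) ⟨
  toℚᵘ (+ b / 1) ∎)
  where open ℚᵘ.≤-Reasoning

^-pos : ∀ p .{{_ : Positive p}} n → Positive (p ^ n)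
^-pos p zero    = _
^-pos p (suc n) = pos*pos⇒pos p (p ^ n) {{^-pos p n}}

^-mono-< : ∀ n {p r} → 0ℚ ≤ p → p < r → p ^ suc n < r ^ suc n
^-mono-< zero    0≤p p<r = *-monoˡ-<-pos 1ℚ p<r
^-mono-< (suc n) {p} {r} 0≤p p<r = begin-strict
  p * p ^ suc n ≤⟨ *-monoˡ-≤-nonNeg p {{nonNegative 0≤p}} (<⇒≤ (^-mono-< n 0≤p p<r)) ⟩
  p * r ^ suc n <⟨ *-monoˡ-<-pos (r ^ suc n) {{^-pos r {{positive (≤-<-trans 0≤p p<r)}} (suc n)}} p<r ⟩
  r * r ^ suc n ∎
  where open ≤-Reasoning

^-cancel-≤ : ∀ n {p r} → 0ℚ ≤ p → r ^ suc n ≤ p ^ suc n → r ≤ p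
^-cancel-≤ n 0≤p rⁿ≤pⁿ = ≮⇒≥ (λ p<r → <-irrefl refl (<-≤-trans (^-mono-< n 0≤p p<r) rⁿ≤pⁿ))

-- Compare fourth powers: s¹² = (s⁴)³ ≤ m³ ≤ q⁴. Thus s³ lies below every rational upper bound of
-- m^(3/4).
s³≤m^¾ : ∀ {s m q} → s ℕ.^ 4 ℕ.≤ m → m ^¾≤ q → + (s ℕ.^ 3) / 1 ≤ q
s³≤m^¾ {s} {m} {q} s⁴≤m (0≤q , m³≤q⁴) = ^-cancel-≤ 3 0≤q (begin
  (+ (s ℕ.^ 3) / 1) ^ 4    ≡⟨ /1-homo-^ (s ℕ.^ 3) 4 ⟨
  + ((s ℕ.^ 3) ℕ.^ 4) / 1  ≡⟨ cong (λ a → + a / 1) s¹² ⟩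
  + ((s ℕ.^ 4) ℕ.^ 3) / 1  ≤⟨ /1-mono-≤ (ℕ.^-monoˡ-≤ 3 s⁴≤m) ⟩
  + (m ℕ.^ 3) / 1          ≤⟨ m³≤q⁴ ⟩
  q ^ 4                    ∎)
  where
  open ≤-Reasoning
  s¹² : (s ℕ.^ 3) ℕ.^ 4 ≡ (s ℕ.^ 4) ℕ.^ 3
  s¹² = trans (ℕ.^-*-assoc s 3 4) (sym (ℕ.^-*-assoc s 4 3))

-- Multiplying by 4 clears the denominator; the constant 14 is 56 / 4.
quarter-bound : ∀ a m c → 4 ℕ.* a ℕ.≤ m ℕ.+ 56 ℕ.* c →
                + a / 1 ≤ + m / 4 + (+ 14 / 1) * (+ c / 1)
quarter-bound a m c 4a≤ = *-cancelˡ-≤-pos (+ 4 / 1) (begin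
  (+ 4 / 1) * (+ a / 1)        ≡⟨ /1-homo-* 4 a ⟨
  + (4 ℕ.* a) / 1              ≤⟨ /1-mono-≤ 4a≤ ⟩
  + (m ℕ.+ 56 ℕ.* c) / 1       ≡⟨ /1-homo-+ m (56 ℕ.* c) ⟩
  + m / 1 + + (56 ℕ.* c) / 1   ≡⟨ cong₂ _+_ (4*[m/4]≡m m) 4*14*c ⟨
  (+ 4 / 1) * (+ m / 4) + (+ 4 / 1) * ((+ 14 / 1) * (+ c / 1))
                               ≡⟨ *-distribˡ-+ (+ 4 / 1) (+ m / 4) _ ⟨
  (+ 4 / 1) * (+ m / 4 + (+ 14 / 1) * (+ c / 1)) ∎)
  where
  open ≤-Reasoning
  4*14*c : (+ 4 / 1) * ((+ 14 / 1) * (+ c / 1)) ≡ + (56 ℕ.* c) / 1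
  4*14*c = trans (sym (*-assoc (+ 4 / 1) (+ 14 / 1) (+ c / 1))) (sym (/1-homo-* 56 c))

mainTheorem10 : ∃[ k₁ ] (0ℚ ≤ k₁ × (∀ (m : ℕ) → 1 ℕ.≤ m →
    ∃[ D ] (Acyclic D × size D ≡ m ×
    (∀ (q : ℚ) → m ^¾≤ q → + mac D / 1 ≤ + m / 4 + k₁ * q))))
-- The digraph and s depend on m alone; q enters only when s³ is replaced by it at the end.
mainTheorem10 = + 14 / 1 , nonNegative⁻¹ (+ 14 / 1) , λ m 1≤m →
  let (s , D , s⁴≤m , acyclic , size≡m , mac≤) = small-mac m 1≤m
  in D , acyclic , size≡m , λ q m^¾≤q → ≤-trans
       (quarter-bound (mac D) m (s ℕ.^ 3) mac≤)
       (+-monoʳ-≤ (+ m / 4) (*-monoˡ-≤-nonNeg (+ 14 / 1) (s³≤m^¾ {s} s⁴≤m m^¾≤q)))
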